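{- Let $a,b,c$ be integers with $a,b\ge 30$. (1) Suppose $0\le c\le 3$. Then the Halve Nim position $a^1b^1c^1$ is a $\mathcal{P}$-position if and only if $$a\oplus b=\tfrac12\bigl(3+(-1)^{c+1}\bigr)+(-1)^{\lfloor\log_2(a/7)\rfloor+\left(1+(-1)^{\lfloor c/2\rfloor+1}\right)/2}.$$ (2) Suppose $4\le c\le 7$. Then the Halve Nim position $a^1b^1c^1$ is a $\mathcal{P}$-position if and only if $$(a+2)\oplus(b+2)=c-2.$$
   Context: Halve Nim is a two-player game played on finitely many piles of coins; players alternate moves and a player who cannot move loses. A move is one of: (i) choose one pile and remove at least one coin from it; (ii) halve the game: simultaneously replace every pile of $m$ coins by a pile of $\lfloor m/2\rfloor$ coins. When there are no coins left, no move is available (halving requires at least one coin to be present). A position is a $\mathcal{P}$-position if the player who is not about to move has a winning strategy (equivalently, every move from it leads to an $\mathcal{N}$-position), and an $\mathcal{N}$-position if the player about to move has a winning strategy. For nonnegative integers $a,b,c$, $a^1b^1c^1$ denotes the position with three piles of sizes $a$, $b$, $c$ (a pile of size $0$ is an empty pile). $\oplus$ denotes bitwise XOR (Nim addition) of nonnegative integers. -}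

module Defs where

open import Data.Bool.Base using (Bool; true; false; not; _xor_; if_then_else_)
open import Data.Bool.Properties using (not-involutive)
open import Data.Integer.Base as ℤ using (ℤ; 1ℤ; -1ℤ)
open import Data.List.Base using (List; _∷_; map)
open import Data.List.Relation.Unary.Any using (Any)
open import Data.Nat.Base
open import Data.Nat.DivMod using (m≡m%n+[m/n]*n; m%n<n; m/n*n≤m; m≥n⇒m/n>0)
open import Data.Nat.Induction using (<-rec)
open import Data.Nat.Logarithm using (⌊log₂_⌋; ⌊log₂⌊n/2⌋⌋≡⌊log₂n⌋∸1)
open import Data.Nat.Properties
open import Data.Product.Base using (_×_; _,_; proj₁; proj₂)
open import Data.Sum.Base using (_⊎_; inj₁; inj₂)
open import Relation.Binary.PropositionalEquality

Position : Set
Position = List ℕ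

data Remove : Position → Position → Set where
  here  : ∀ {m n ns} → m < n → Remove (n ∷ ns) (m ∷ ns)
  there : ∀ {n ms ns} → Remove ns ms → Remove (n ∷ ns) (n ∷ ms)

infix 4 _⟶_

data _⟶_ : Position → Position → Set where
  remove : ∀ {p q} → Remove p q → p ⟶ q
  halve  : ∀ {p} → Any (0 <_) p → p ⟶ map ⌊_/2⌋ p

-- Every play is finite, so the least fixed point below decides each position.
mutual
  data 𝒫 (p : Position) : Set where
    allMoves : (∀ {q} → p ⟶ q → 𝒩 q) → 𝒫 p

  data 𝒩 (p : Position) : Set where
    someMove : ∀ {q} → p ⟶ q → 𝒫 q → 𝒩 p

odd : ℕ → Bool
odd zero    = false
odd (suc n) = not (odd n)

fromBit : Bool → ℕ
fromBit b = if b then 1 else 0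

bit : ℕ → ℕ → Bool
bit zero    n = odd n
bit (suc i) n = bit i ⌊ n /2⌋

xorBits : ℕ → ℕ → ℕ → ℕ
xorBits zero    m n = 0
xorBits (suc k) m n = fromBit (odd m xor odd n) + 2 * xorBits k ⌊ m /2⌋ ⌊ n /2⌋

infixl 6 _⊕_

-- m + n bounds the number of binary digits of both m and n; see bit-⊕.
_⊕_ : ℕ → ℕ → ℕ
m ⊕ n = xorBits (m + n) m n

private
  odd-2* : ∀ k → odd (2 * k) ≡ false
  odd-2* zero = refl
  odd-2* (suc k) rewrite +-suc k (k + 0) = trans (not-involutive _) (odd-2* k)

  half-2* : ∀ k → ⌊ 2 * k /2⌋ ≡ k
  half-2* zero = refl
  half-2* (suc k) rewrite +-suc k (k + 0) = cong suc (half-2* k)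

  half-1+2* : ∀ k → ⌊ suc (2 * k) /2⌋ ≡ k
  half-1+2* zero = refl
  half-1+2* (suc k) rewrite +-suc k (k + 0) = cong suc (half-1+2* k)

  odd-digit : ∀ b k → odd (fromBit b + 2 * k) ≡ b
  odd-digit true  k = cong not (odd-2* k)
  odd-digit false k = odd-2* k

  half-digit : ∀ b k → ⌊ fromBit b + 2 * k /2⌋ ≡ k
  half-digit true  k = half-1+2* k
  half-digit false k = half-2* k

  bit-0 : ∀ i → bit i 0 ≡ false
  bit-0 zero    = refl
  bit-0 (suc i) = bit-0 i

  halves≤ : ∀ k m n → m + n ≤ suc k → ⌊ m /2⌋ + ⌊ n /2⌋ ≤ k
  halves≤ k zero    zero    _       = z≤n
  halves≤ k zero    (suc n) (s≤s h) = ≤-trans (≤-pred (⌊n/2⌋<n n)) h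
  halves≤ k (suc m) n       (s≤s h) =
    ≤-trans (+-mono-≤ (≤-pred (⌊n/2⌋<n m)) (⌊n/2⌋≤n n)) h

  bit-xorBits : ∀ k m n → m + n ≤ k → ∀ i → bit i (xorBits k m n) ≡ bit i m xor bit i n
  bit-xorBits zero zero zero _ i rewrite bit-0 i = refl
  bit-xorBits (suc k) m n h zero = odd-digit (odd m xor odd n) (xorBits k ⌊ m /2⌋ ⌊ n /2⌋)
  bit-xorBits (suc k) m n h (suc i) =
    trans (cong (bit i) (half-digit (odd m xor odd n) (xorBits k ⌊ m /2⌋ ⌊ n /2⌋)))
          (bit-xorBits k ⌊ m /2⌋ ⌊ n /2⌋ (halves≤ k m n h) i)

bit-⊕ : ∀ m n i → bit i (m ⊕ n) ≡ bit i m xor bit i n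
bit-⊕ m n = bit-xorBits (m + n) m n ≤-refl

-- The floor of the base-2 logarithm of the rational m / n, for m ≥ n.  Taking
-- the integer part of m / n first is harmless, since powers of 2 are integers;
-- see ⌊log₂[/]⌋-lower and ⌊log₂[/]⌋-upper.
⌊log₂[_/_]⌋ : (m n : ℕ) .{{_ : NonZero n}} → ℕ
⌊log₂[ m / n ]⌋ = ⌊log₂ (m / n) ⌋

private
  n<2+2*half : ∀ n → n < 2 * suc ⌊ n /2⌋
  n<2+2*half 0 = s≤s z≤n
  n<2+2*half 1 = s≤s (s≤s z≤n)
  n<2+2*half (suc (suc n)) =
    subst (suc (suc n) <_) (sym (*-suc 2 (suc ⌊ n /2⌋))) (s≤s (s≤s (n<2+2*half n)))

  2*half≤n : ∀ n → 2 * ⌊ n /2⌋ ≤ n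
  2*half≤n 0 = z≤n
  2*half≤n 1 = z≤n
  2*half≤n (suc (suc n)) =
    subst (_≤ suc (suc n)) (sym (*-suc 2 ⌊ n /2⌋)) (s≤s (s≤s (2*half≤n n)))

  log₂-step : ∀ n → ⌊log₂ 2 + n ⌋ ≡ suc ⌊log₂ suc ⌊ n /2⌋ ⌋
  log₂-step n = cong suc (sym (⌊log₂⌊n/2⌋⌋≡⌊log₂n⌋∸1 (2 + n)))

  log₂-bounds : ∀ n → 0 < n → 2 ^ ⌊log₂ n ⌋ ≤ n × n < 2 ^ suc ⌊log₂ n ⌋
  log₂-bounds = <-rec _ go
    where
    go : ∀ n → (∀ {m} → m < n → 0 < m → 2 ^ ⌊log₂ m ⌋ ≤ m × m < 2 ^ suc ⌊log₂ m ⌋) →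
         0 < n → 2 ^ ⌊log₂ n ⌋ ≤ n × n < 2 ^ suc ⌊log₂ n ⌋
    go 1 _ _ = s≤s z≤n , s≤s (s≤s z≤n)
    go n@(suc (suc n′)) rec _ with rec (⌊n/2⌋<n (suc n′)) (s≤s z≤n)
    ... | lo , hi = subst (λ l → 2 ^ l ≤ n × n < 2 ^ suc l) (sym (log₂-step n′))
                      ( ≤-trans (*-monoʳ-≤ 2 lo) (2*half≤n n)
                      , ≤-trans (n<2+2*half n) (*-monoʳ-≤ 2 hi))

⌊log₂[/]⌋-lower : ∀ m n .{{_ : NonZero n}} → n ≤ m → 2 ^ ⌊log₂[ m / n ]⌋ * n ≤ m
⌊log₂[/]⌋-lower m n n≤m =
  ≤-trans (*-monoˡ-≤ n (proj₁ (log₂-bounds (m / n) (m≥n⇒m/n>0 n≤m)))) (m/n*n≤m m n)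

⌊log₂[/]⌋-upper : ∀ m n .{{_ : NonZero n}} → n ≤ m → m < 2 ^ suc ⌊log₂[ m / n ]⌋ * n
⌊log₂[/]⌋-upper m n n≤m = begin-strict
  m                       ≡⟨ m≡m%n+[m/n]*n m n ⟩
  m % n + (m / n) * n     <⟨ +-monoˡ-< ((m / n) * n) (m%n<n m n) ⟩
  suc (m / n) * n         ≤⟨ *-monoˡ-≤ n (proj₂ (log₂-bounds (m / n) (m≥n⇒m/n>0 n≤m))) ⟩
  2 ^ suc ⌊log₂[ m / n ]⌋ * n ∎
  where open ≤-Reasoning

-- Rounds down in general, but is exact on 3 + (-1)ⁿ and 1 + (-1)ⁿ; see half-3±1
-- and half-1±1.
half : ℤ → ℤ
half i = i ℤ./ ℤ.+ 2

private
  ±1 : ∀ n → -1ℤ ℤ.^ n ≡ 1ℤ ⊎ -1ℤ ℤ.^ n ≡ -1ℤ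
  ±1 zero = inj₁ refl
  ±1 (suc n) with ±1 n
  ... | inj₁ eq rewrite eq = inj₂ refl
  ... | inj₂ eq rewrite eq = inj₁ refl

half-3±1 : ∀ n → let i = ℤ.+ 3 ℤ.+ -1ℤ ℤ.^ n in ℤ.+ 2 ℤ.* half i ≡ i
half-3±1 n with ±1 n
... | inj₁ eq rewrite eq = refl
... | inj₂ eq rewrite eq = refl

half-1±1 : ∀ n → let i = 1ℤ ℤ.+ -1ℤ ℤ.^ n in ℤ.+ 2 ℤ.* half i ≡ i × ℤ.+ ℤ.∣ half i ∣ ≡ half i
half-1±1 n with ±1 n
... | inj₁ eq rewrite eq = refl , refl
... | inj₂ eq rewrite eq = refl , refl

{-# OPTIONS --safe #-}
-- For fixed c ≤ 7 the 𝒫-positions (a , b , c) are the graph of an involution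
-- partner c.  Let piles a ≥ 30 have level ⌊log₂ (a / 7)⌋.  Then partner c a is
-- a ⊕ v with v ≤ 3 determined by c and the parity of the level when c ≤ 3, and
-- ((a + 2) ⊕ (c - 2)) - 2 when 4 ≤ c.  In both cases the lowest bits of a, b, c
-- sum to 0, so one only has to match the halves of the piles.  Halving flips the
-- parity of the level; hence the two choices of v alternate, and halving never
-- leads from a paired position to a paired one.  Conversely, if b is below the
-- partner of a and a below the partner of b, then a and b lie so close that
-- either a smaller third pile or halving produces a paired position.  For
-- a < 60, where the piles or their halves may be irregular, the same facts are
-- finitely many instances.
module Submission where

open import Defs
open import Data.Bool.Base using (Bool; true; false; not; _xor_; if_then_else_)
open import Data.Bool.Properties
  using (not-involutive; not-injective; not-¬; xor-assoc; xor-same; xor-identityʳ; xor-comm)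
open import Data.Empty using (⊥; ⊥-elim)
open import Data.Integer.Base as ℤ using (ℤ; +_; -1ℤ; 1ℤ; ∣_∣)
open import Data.Integer.Properties using (+-injective)
open import Data.List.Base using (List; []; _∷_; map; head; drop)
open import Data.List.Relation.Unary.Any using (Any; here; there)
open import Data.Maybe.Base using (fromMaybe)
open import Data.Nat.Base
open import Data.Nat.DivMod using (m/n/o≡m/[n*o]; m/n≡1+[m∸n]/n)
open import Data.Nat.Induction using (<-wellFounded)
open import Data.Nat.Logarithm using (⌊log₂_⌋; ⌊log₂⌊n/2⌋⌋≡⌊log₂n⌋∸1)
open import Data.Nat.ListAction using (sum)
open import Data.Nat.Properties
open import Data.Product.Base using (_×_; _,_; ∃; proj₁; proj₂)
open import Data.Sum.Base using (_⊎_; inj₁; inj₂)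
open import Function.Base using (_∘_)
open import Function.Bundles using (_⇔_; mk⇔; module Equivalence)
import Function.Properties.Equivalence as ⇔
open import Induction.WellFounded using (Acc; acc)
open import Relation.Binary.Definitions using (tri<; tri≈; tri>)
open import Relation.Binary.PropositionalEquality
open import Relation.Nullary using (Dec; yes; no; ¬_; contradiction)
open import Relation.Nullary.Decidable using (from-yes; map′; ¬?; _→-dec_; _⊎-dec_)

-- Plays on an arbitrary set of positions

𝒫∧𝒩⇒⊥ : ∀ {p} → 𝒫 p → 𝒩 p → ⊥
𝒫∧𝒩⇒⊥ (allMoves h) (someMove m Pq) = 𝒫∧𝒩⇒⊥ Pq (h m)

sum-halves≤ : ∀ p → sum (map ⌊_/2⌋ p) ≤ sum p
sum-halves≤ []      = z≤n
sum-halves≤ (n ∷ p) = +-mono-≤ (⌊n/2⌋≤n n) (sum-halves≤ p)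

sum-halves< : ∀ {p} → Any (0 <_) p → sum (map ⌊_/2⌋ p) < sum p
sum-halves< {suc n ∷ p} (here _)   = +-mono-<-≤ (⌊n/2⌋<n n) (sum-halves≤ p)
sum-halves< {n ∷ p}     (there 0<) = +-mono-≤-< (⌊n/2⌋≤n n) (sum-halves< 0<)

sum-remove : ∀ {p q} → Remove p q → sum q < sum p
sum-remove (here {ns = ns} m<n) = +-monoˡ-< (sum ns) m<n
sum-remove (there {n} r)        = +-monoʳ-< n (sum-remove r)

sum-⟶ : ∀ {p q} → p ⟶ q → sum q < sum p
sum-⟶ (remove r) = sum-remove r
sum-⟶ (halve 0<) = sum-halves< 0<

-- A kernel in the sense of graph theory, for the digraph of moves on the closed set `D`. Every move
-- lowers the number of coins, so induction on that number identifies `K` with the 𝒫-positions.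
record Kernel (D K : Position → Set) : Set where
  field
    closed    : ∀ {p q} → D p → p ⟶ q → D q
    decidable : ∀ {p} → D p → Dec (K p)
    stable    : ∀ {p q} → D p → K p → p ⟶ q → ¬ K q
    absorbing : ∀ {p} → D p → ¬ K p → ∃ λ q → (p ⟶ q) × K q

  classify : ∀ {p} → Acc _<_ (sum p) → D p → (K p → 𝒫 p) × (¬ K p → 𝒩 p)
  classify (acc rec) d =
      (λ k → allMoves λ m → proj₂ (classify (rec (sum-⟶ m)) (closed d m)) (stable d k m))
    , (λ ¬k → let q , m , k = absorbing d ¬k in
              someMove m (proj₁ (classify (rec (sum-⟶ m)) (closed d m)) k))

  𝒫⇔K : ∀ {p} → D p → 𝒫 p ⇔ K p
  𝒫⇔K {p} d = mk⇔ to (proj₁ outcome)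
    where
    outcome : (K p → 𝒫 p) × (¬ K p → 𝒩 p)
    outcome = classify (<-wellFounded _) d
    to : 𝒫 p → K p
    to Pp with decidable d
    ... | yes k = k
    ... | no ¬k = ⊥-elim (𝒫∧𝒩⇒⊥ Pp (proj₂ outcome ¬k))

-- Binary digits

-- The number `2 * n + fromBit i`, in a form on which `odd` and `⌊_/2⌋` compute along the recursion
-- on `n`.
join : Bool → ℕ → ℕ
join i zero    = fromBit i
join i (suc n) = suc (suc (join i n))

odd-join : ∀ i n → odd (join i n) ≡ i
odd-join true  zero    = refl
odd-join false zero    = refl
odd-join i     (suc n) = trans (not-involutive _) (odd-join i n)

half-join : ∀ i n → ⌊ join i n /2⌋ ≡ n
half-join true  zero    = refl
half-join false zero    = refl
half-join i     (suc n) = cong suc (half-join i n)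

join-digits : ∀ n → join (odd n) ⌊ n /2⌋ ≡ n
join-digits 0 = refl
join-digits 1 = refl
join-digits (suc (suc n)) rewrite not-involutive (odd n) = cong (suc ∘ suc) (join-digits n)

join-injective : ∀ {i j x y} → join i x ≡ join j y → i ≡ j × x ≡ y
join-injective {i} {j} {x} {y} eq =
    trans (sym (odd-join i x)) (trans (cong odd eq) (odd-join j y))
  , trans (sym (half-join i x)) (trans (cong ⌊_/2⌋ eq) (half-join j y))

digits : ∀ {n i x} → odd n ≡ i → ⌊ n /2⌋ ≡ x → n ≡ join i x
digits {n} refl refl = sym (join-digits n)

join-<⁻ : ∀ i j x y → join i x < join j y → x < y ⊎ (x ≡ y × i ≡ false × j ≡ true)
join-<⁻ false true  zero    zero    _               = inj₂ (refl , refl , refl)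
join-<⁻ true  true  zero    zero    (s≤s ())
join-<⁻ i     j     zero    (suc y) _               = inj₁ z<s
join-<⁻ i     false (suc x) zero    ()
join-<⁻ i     true  (suc x) zero    (s≤s ())
join-<⁻ i     j     (suc x) (suc y) (s≤s (s≤s x<y)) with join-<⁻ i j x y x<y
... | inj₁ x<y′       = inj₁ (s≤s x<y′)
... | inj₂ (eq , i,j) = inj₂ (cong suc eq , i,j)

join-mono : ∀ i {x y} → x ≤ y → join false x ≤ join i y
join-mono i {y = zero}  z≤n       = z≤n
join-mono i {y = suc y} z≤n       = z≤n
join-mono i             (s≤s x≤y) = s≤s (s≤s (join-mono i x≤y))

join-mono-< : ∀ i j {x y} → x < y → join i x < join j y
join-mono-< true  j {zero}  {suc y} _         = s≤s (s≤s z≤n)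
join-mono-< false j {zero}  {suc y} _         = s≤s z≤n
join-mono-< i     j {suc x} {suc y} (s≤s x<y) = s≤s (s≤s (join-mono-< i j x<y))

join-false<join-true : ∀ n → join false n < join true n
join-false<join-true zero    = z<s
join-false<join-true (suc n) = s≤s (s≤s (join-false<join-true n))

-- `k` is fuel: it bounds both numbers, and halving them lowers the bound by one.
bit-cong⁻ : ∀ k m n → m ≤ k → n ≤ k → (∀ i → bit i m ≡ bit i n) → m ≡ n
bit-cong⁻ zero    m n z≤n z≤n eq = refl
bit-cong⁻ (suc k) m n m≤ n≤ eq =
  trans (digits (eq 0) (bit-cong⁻ k ⌊ m /2⌋ ⌊ n /2⌋ (half≤ m≤) (half≤ n≤) (eq ∘ suc)))
        (join-digits n)
  where
  half≤ : ∀ {l} → l ≤ suc k → ⌊ l /2⌋ ≤ k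
  half≤ {zero}  _  = z≤n
  half≤ {suc l} l≤ = ≤-pred (<-≤-trans (⌊n/2⌋<n l) l≤)

bit-ext : ∀ {m n} → (∀ i → bit i m ≡ bit i n) → m ≡ n
bit-ext {m} {n} = bit-cong⁻ (m + n) m n (m≤m+n m n) (m≤n+m n m)

half-⊕ : ∀ m n → ⌊ m ⊕ n /2⌋ ≡ ⌊ m /2⌋ ⊕ ⌊ n /2⌋
half-⊕ m n = bit-ext λ i → trans (bit-⊕ m n (suc i)) (sym (bit-⊕ ⌊ m /2⌋ ⌊ n /2⌋ i))

xor-solve : ∀ x {y z} → x xor y ≡ z → y ≡ x xor z
xor-solve x {y} refl =
  sym (trans (sym (xor-assoc x x y)) (cong (_xor y) (xor-same x)))

-- XOR acts digit by digit. The lowest digit is solved for `odd n`, since the second pile is the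
-- unknown. Iteration brings the sums 1 and 2 down to 0.
⊕≡join : ∀ m n i w → (m ⊕ n ≡ join i w) ⇔ (odd n ≡ odd m xor i × ⌊ m /2⌋ ⊕ ⌊ n /2⌋ ≡ w)
⊕≡join m n i w = mk⇔
  (λ eq → xor-solve (odd m) (trans (sym (bit-⊕ m n 0)) (trans (cong odd eq) (odd-join i w)))
        , trans (sym (half-⊕ m n)) (trans (cong ⌊_/2⌋ eq) (half-join i w)))
  (λ (o , h) → digits (trans (bit-⊕ m n 0) (sym (xor-solve (odd m) (sym o))))
                      (trans (half-⊕ m n) h))

bit-0 : ∀ i → bit i 0 ≡ false
bit-0 zero    = refl
bit-0 (suc i) = bit-0 i

⊕≡0 : ∀ m n → (m ⊕ n ≡ 0) ⇔ (n ≡ m)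
⊕≡0 m n = mk⇔
  (λ eq → bit-ext λ i → trans
    (xor-solve (bit i m) (trans (sym (bit-⊕ m n i)) (trans (cong (bit i) eq) (bit-0 i))))
    (xor-identityʳ _))
  (λ { refl → bit-ext λ i → trans (bit-⊕ m m i) (trans (xor-same (bit i m)) (sym (bit-0 i))) })

-- n ⊕ 1 and n ⊕ 2, by recursions that commute with adding 2 and 4 definitionally.
flip₁ : ℕ → ℕ
flip₁ 0             = 1
flip₁ 1             = 0
flip₁ (suc (suc n)) = suc (suc (flip₁ n))

flip₂ : ℕ → ℕ
flip₂ 0 = 2
flip₂ 1 = 3
flip₂ 2 = 0
flip₂ 3 = 1
flip₂ (suc (suc (suc (suc n)))) = suc (suc (suc (suc (flip₂ n))))

odd-flip₁ : ∀ n → odd (flip₁ n) ≡ not (odd n)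
odd-flip₁ 0             = refl
odd-flip₁ 1             = refl
odd-flip₁ (suc (suc n)) = cong (not ∘ not) (odd-flip₁ n)

half-flip₁ : ∀ n → ⌊ flip₁ n /2⌋ ≡ ⌊ n /2⌋
half-flip₁ 0             = refl
half-flip₁ 1             = refl
half-flip₁ (suc (suc n)) = cong suc (half-flip₁ n)

odd-flip₂ : ∀ n → odd (flip₂ n) ≡ odd n
odd-flip₂ 0 = refl
odd-flip₂ 1 = refl
odd-flip₂ 2 = refl
odd-flip₂ 3 = refl
odd-flip₂ (suc (suc (suc (suc n)))) = cong (not ∘ not ∘ not ∘ not) (odd-flip₂ n)

half-flip₂ : ∀ n → ⌊ flip₂ n /2⌋ ≡ flip₁ ⌊ n /2⌋
half-flip₂ 0 = refl
half-flip₂ 1 = refl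
half-flip₂ 2 = refl
half-flip₂ 3 = refl
half-flip₂ (suc (suc (suc (suc n)))) = cong (suc ∘ suc) (half-flip₂ n)

flip₁-involutive : ∀ n → flip₁ (flip₁ n) ≡ n
flip₁-involutive 0             = refl
flip₁-involutive 1             = refl
flip₁-involutive (suc (suc n)) = cong (suc ∘ suc) (flip₁-involutive n)

flip₂-involutive : ∀ n → flip₂ (flip₂ n) ≡ n
flip₂-involutive 0 = refl
flip₂-involutive 1 = refl
flip₂-involutive 2 = refl
flip₂-involutive 3 = refl
flip₂-involutive (suc (suc (suc (suc n)))) = cong (λ m → 4 + m) (flip₂-involutive n)

flip₁≢ : ∀ n → flip₁ n ≢ n
flip₁≢ n eq = not-¬ (cong odd eq) (odd-flip₁ n)

flip₂≢ : ∀ n → flip₂ n ≢ n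
flip₂≢ n eq = flip₁≢ ⌊ n /2⌋ (trans (sym (half-flip₂ n)) (cong ⌊_/2⌋ eq))

-- One side is `n` and the other `2 + n`; the parity of `n` decides which.
flip₁-suc≢ : ∀ n → flip₁ (suc n) ≢ suc (flip₁ n)
flip₁-suc≢ (suc (suc n)) eq = flip₁-suc≢ n (suc-injective (suc-injective eq))

⊕≡1 : ∀ m n → (m ⊕ n ≡ 1) ⇔ (n ≡ flip₁ m)
⊕≡1 m n = ⇔.trans (⊕≡join m n true 0) (mk⇔
  (λ (o , h) → trans
     (digits (trans o (xor-comm (odd m) true)) (Equivalence.to (⊕≡0 ⌊ m /2⌋ ⌊ n /2⌋) h))
     (sym (digits (odd-flip₁ m) (half-flip₁ m))))
  (λ { refl → trans (odd-flip₁ m) (xor-comm true (odd m))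
            , Equivalence.from (⊕≡0 ⌊ m /2⌋ _) (half-flip₁ m) }))

⊕≡2 : ∀ m n → (m ⊕ n ≡ 2) ⇔ (n ≡ flip₂ m)
⊕≡2 m n = ⇔.trans (⊕≡join m n false 1) (mk⇔
  (λ (o , h) → trans
     (digits (trans o (xor-identityʳ (odd m))) (Equivalence.to (⊕≡1 ⌊ m /2⌋ ⌊ n /2⌋) h))
     (sym (digits (odd-flip₂ m) (half-flip₂ m))))
  (λ { refl → trans (odd-flip₂ m) (sym (xor-identityʳ (odd m)))
            , Equivalence.from (⊕≡1 ⌊ m /2⌋ _) (half-flip₂ m) }))

flip₁≤ : ∀ n → flip₁ n ≤ suc n
flip₁≤ 0             = s≤s z≤n
flip₁≤ 1             = z≤n
flip₁≤ (suc (suc n)) = s≤s (s≤s (flip₁≤ n))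

-- `flip₁` preserves each block {2k, 2k + 1}, so the inequalities force `m` and `n` into one block.
-- Its upper member is sent to the least element of the block, so both numbers are 2k.
flip₁-crossing : ∀ m n → m < flip₁ n → n < flip₁ m → m ≡ n
flip₁-crossing 0 0 _ _ = refl
flip₁-crossing (suc (suc m)) (suc (suc n)) (s≤s (s≤s p)) (s≤s (s≤s q)) =
  cong (suc ∘ suc) (flip₁-crossing m n p q)
flip₁-crossing 0 (suc (suc n)) _ (s≤s ())
flip₁-crossing (suc (suc m)) 0 (s≤s ()) _

-- The same with blocks of four: both numbers must be in the lower half {4k, 4k + 1} of one block.
flip₂-crossing : ∀ m n → m < flip₂ n → n < flip₂ m → m ≡ n ⊎ m ≡ flip₁ n
flip₂-crossing 0 0 _ _ = inj₁ refl
flip₂-crossing 0 1 _ _ = inj₂ refl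
flip₂-crossing 1 0 _ _ = inj₂ refl
flip₂-crossing 1 1 _ _ = inj₁ refl
flip₂-crossing 2 1 _ ()
flip₂-crossing 3 1 _ (s≤s ())
flip₂-crossing 3 0 (s≤s (s≤s ())) _
flip₂-crossing 0 (suc (suc (suc (suc n)))) _ (s≤s (s≤s ()))
flip₂-crossing 1 (suc (suc (suc (suc n)))) _ (s≤s (s≤s (s≤s ())))
flip₂-crossing (suc (suc (suc (suc m)))) 0 (s≤s (s≤s ())) _
flip₂-crossing (suc (suc (suc (suc m)))) 1 (s≤s (s≤s (s≤s ()))) _
flip₂-crossing (suc (suc (suc (suc m)))) 3 (s≤s ()) _
flip₂-crossing (suc (suc (suc (suc m)))) (suc (suc (suc (suc n))))
               (s≤s (s≤s (s≤s (s≤s p)))) (s≤s (s≤s (s≤s (s≤s q))))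
  with flip₂-crossing m n p q
... | inj₁ eq = inj₁ (cong (λ k → 4 + k) eq)
... | inj₂ eq = inj₂ (cong (λ k → 4 + k) eq)

-- The parity of ⌊log₂ (n / 7)⌋

-- Opaque because the logarithm recurses on a proof of well-foundedness, whose
-- normal form at a variable is unmanageable.
opaque
  oddLevel : ℕ → Bool
  oddLevel n = odd ⌊log₂[ n / 7 ]⌋

  oddLevel-def : ∀ n → oddLevel n ≡ odd ⌊log₂[ n / 7 ]⌋
  oddLevel-def n = refl

⌊n/2⌋≡n/2 : ∀ n → ⌊ n /2⌋ ≡ n / 2
⌊n/2⌋≡n/2 0 = refl
⌊n/2⌋≡n/2 1 = refl
⌊n/2⌋≡n/2 (suc (suc n)) =
  trans (cong suc (⌊n/2⌋≡n/2 n)) (sym (m/n≡1+[m∸n]/n {suc (suc n)} {2} (s≤s (s≤s z≤n))))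

half-/7 : ∀ n → ⌊ n /2⌋ / 7 ≡ ⌊ n / 7 /2⌋
half-/7 n = begin
  ⌊ n /2⌋ / 7  ≡⟨ cong (_/ 7) (⌊n/2⌋≡n/2 n) ⟩
  n / 2 / 7    ≡⟨ m/n/o≡m/[n*o] n 2 7 ⟩
  n / 14       ≡⟨ m/n/o≡m/[n*o] n 7 2 ⟨
  n / 7 / 2    ≡⟨ ⌊n/2⌋≡n/2 (n / 7) ⟨
  ⌊ n / 7 /2⌋  ∎
  where open ≡-Reasoning

log₂-half : ∀ n → ⌊log₂ 2 + n ⌋ ≡ suc ⌊log₂ suc ⌊ n /2⌋ ⌋
log₂-half n = cong suc (sym (⌊log₂⌊n/2⌋⌋≡⌊log₂n⌋∸1 (2 + n)))

opaque
  unfolding oddLevel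

  -- Halving commutes with floor division by 7, and a pile of at least 14 has quotient at least 2,
  -- so halving lowers the logarithm by exactly one.
  oddLevel-half : ∀ n → oddLevel (14 + n) ≡ not (oddLevel (7 + ⌊ n /2⌋))
  oddLevel-half n = cong odd (begin
    ⌊log₂ (14 + n) / 7 ⌋                  ≡⟨ cong ⌊log₂_⌋ 14+n/7 ⟩
    ⌊log₂ 2 + n / 7 ⌋                     ≡⟨ log₂-half (n / 7) ⟩
    suc ⌊log₂ suc ⌊ n / 7 /2⌋ ⌋           ≡⟨ cong (suc ∘ ⌊log₂_⌋ ∘ suc) (half-/7 n) ⟨
    suc ⌊log₂ suc (⌊ n /2⌋ / 7) ⌋         ≡⟨ cong (suc ∘ ⌊log₂_⌋) (7+n/7 ⌊ n /2⌋) ⟨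
    suc ⌊log₂ (7 + ⌊ n /2⌋) / 7 ⌋         ∎)
    where
    open ≡-Reasoning
    7+n/7 : ∀ n → (7 + n) / 7 ≡ suc (n / 7)
    7+n/7 n = m/n≡1+[m∸n]/n {7 + n} {7} (m≤m+n 7 n)
    14+n/7 : (14 + n) / 7 ≡ 2 + n / 7
    14+n/7 = trans (7+n/7 (7 + n)) (cong suc (7+n/7 n))

-- Both piles have the same half, and that half determines the level.
oddLevel-flip₁ : ∀ n → oddLevel (14 + flip₁ n) ≡ oddLevel (14 + n)
oddLevel-flip₁ n = begin
  oddLevel (14 + flip₁ n)            ≡⟨ oddLevel-half (flip₁ n) ⟩
  not (oddLevel (7 + ⌊ flip₁ n /2⌋)) ≡⟨ cong (λ m → not (oddLevel (7 + m))) (half-flip₁ n) ⟩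
  not (oddLevel (7 + ⌊ n /2⌋))       ≡⟨ oddLevel-half n ⟨
  oddLevel (14 + n)                  ∎
  where open ≡-Reasoning

-- The partner function

-- Row c lists the greedy values for a < 30: partner c a is the least b for which
-- no move leads from (a , b , c) to a position already paired.
table : ℕ → List ℕ
table 0 = 0 ∷ 2 ∷ 1 ∷ 3 ∷ 4 ∷ 5 ∷ 8 ∷ 9 ∷ 6 ∷ 7 ∷ 12 ∷ 13 ∷ 10 ∷ 11 ∷ 14 ∷
          15 ∷ 16 ∷ 17 ∷ 18 ∷ 19 ∷ 20 ∷ 21 ∷ 22 ∷ 23 ∷ 24 ∷ 25 ∷ 26 ∷ 27 ∷ 30 ∷ 31 ∷ []
table 1 = 2 ∷ 3 ∷ 0 ∷ 1 ∷ 5 ∷ 4 ∷ 9 ∷ 8 ∷ 7 ∷ 6 ∷ 13 ∷ 12 ∷ 11 ∷ 10 ∷ 15 ∷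
          14 ∷ 17 ∷ 16 ∷ 19 ∷ 18 ∷ 21 ∷ 20 ∷ 23 ∷ 22 ∷ 25 ∷ 24 ∷ 27 ∷ 26 ∷ 31 ∷ 30 ∷ []
table 2 = 1 ∷ 0 ∷ 2 ∷ 4 ∷ 3 ∷ 6 ∷ 5 ∷ 7 ∷ 8 ∷ 9 ∷ 10 ∷ 11 ∷ 12 ∷ 13 ∷ 18 ∷
          19 ∷ 20 ∷ 21 ∷ 14 ∷ 15 ∷ 16 ∷ 17 ∷ 26 ∷ 27 ∷ 28 ∷ 29 ∷ 22 ∷ 23 ∷ 24 ∷ 25 ∷ []
table 3 = 3 ∷ 1 ∷ 4 ∷ 0 ∷ 2 ∷ 7 ∷ 6 ∷ 5 ∷ 9 ∷ 8 ∷ 11 ∷ 10 ∷ 13 ∷ 12 ∷ 19 ∷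
          18 ∷ 21 ∷ 20 ∷ 15 ∷ 14 ∷ 17 ∷ 16 ∷ 27 ∷ 26 ∷ 29 ∷ 28 ∷ 23 ∷ 22 ∷ 25 ∷ 24 ∷ []
table 4 = 4 ∷ 5 ∷ 3 ∷ 2 ∷ 0 ∷ 1 ∷ 7 ∷ 6 ∷ 10 ∷ 11 ∷ 8 ∷ 9 ∷ 14 ∷ 15 ∷ 12 ∷
          13 ∷ 18 ∷ 19 ∷ 16 ∷ 17 ∷ 22 ∷ 23 ∷ 20 ∷ 21 ∷ 26 ∷ 27 ∷ 24 ∷ 25 ∷ 28 ∷ 29 ∷ []
table 5 = 5 ∷ 4 ∷ 6 ∷ 7 ∷ 1 ∷ 0 ∷ 2 ∷ 3 ∷ 11 ∷ 10 ∷ 9 ∷ 8 ∷ 15 ∷ 14 ∷ 13 ∷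
          12 ∷ 19 ∷ 18 ∷ 17 ∷ 16 ∷ 23 ∷ 22 ∷ 21 ∷ 20 ∷ 27 ∷ 26 ∷ 25 ∷ 24 ∷ 29 ∷ 28 ∷ []
table 6 = 8 ∷ 9 ∷ 5 ∷ 6 ∷ 7 ∷ 2 ∷ 3 ∷ 4 ∷ 0 ∷ 1 ∷ 16 ∷ 17 ∷ 18 ∷ 19 ∷ 20 ∷
          21 ∷ 10 ∷ 11 ∷ 12 ∷ 13 ∷ 14 ∷ 15 ∷ 24 ∷ 25 ∷ 22 ∷ 23 ∷ 28 ∷ 29 ∷ 26 ∷ 27 ∷ []
table _ = 9 ∷ 8 ∷ 7 ∷ 5 ∷ 6 ∷ 3 ∷ 4 ∷ 2 ∷ 1 ∷ 0 ∷ 17 ∷ 16 ∷ 19 ∷ 18 ∷ 21 ∷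
          20 ∷ 11 ∷ 10 ∷ 13 ∷ 12 ∷ 15 ∷ 14 ∷ 25 ∷ 24 ∷ 23 ∷ 22 ∷ 29 ∷ 28 ∷ 27 ∷ 26 ∷ []

toggle : Bool → ℕ → ℕ
toggle i n = if i then flip₁ n else n

-- Position (m , n , k) of half-size piles stands for the four positions with
-- ⌊ a /2⌋ = m, ⌊ b /2⌋ = n, ⌊ c /2⌋ = k and even a + b + c.
halfPartner : ℕ → ℕ → ℕ
halfPartner 0 n = toggle (oddLevel n) n
halfPartner 1 n = toggle (not (oddLevel n)) n
halfPartner 2 n = pred (flip₁ (suc n))
halfPartner _ n = pred (flip₂ (suc n))

largePartner : ℕ → ℕ → ℕ
largePartner c a = join (odd a xor odd c) (halfPartner ⌊ c /2⌋ ⌊ a /2⌋)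

partner : ℕ → ℕ → ℕ
partner c a = if a <ᵇ 30 then fromMaybe 0 (head (drop a (table c))) else largePartner c a

odd-largePartner : ∀ c a → odd (largePartner c a) ≡ odd a xor odd c
odd-largePartner c a = odd-join _ (halfPartner ⌊ c /2⌋ ⌊ a /2⌋)

half-largePartner : ∀ c a → ⌊ largePartner c a /2⌋ ≡ halfPartner ⌊ c /2⌋ ⌊ a /2⌋
half-largePartner c a = half-join (odd a xor odd c) _

-- Finite verification for piles below 60

opaque
  unfolding oddLevel

  small-involutive : ∀ {a} → a < 60 → ∀ {c} → c < 8 → partner c (partner c a) ≡ a
  small-involutive = from-yes (allUpTo? (λ a → allUpTo? (λ c → partner c (partner c a) ≟ a) 8) 60)

  small-distinct : ∀ {a} → a < 60 → ∀ {c} → c < 8 → ∀ {c′} → c′ < c → partner c a ≢ partner c′ a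
  small-distinct = from-yes (allUpTo? (λ a → allUpTo? (λ c → allUpTo? (λ c′ →
    ¬? (partner c a ≟ partner c′ a)) c) 8) 60)

  -- The exception is the empty position: it is paired and equals its own half, but it admits no
  -- halving move.
  small-halve : ∀ {a} → a < 60 → ∀ {c} → c < 8 →
    ⌊ partner c a /2⌋ ≡ partner ⌊ c /2⌋ ⌊ a /2⌋ → a + partner c a + c ≡ 0
  small-halve = from-yes (allUpTo? (λ a → allUpTo? (λ c →
    (⌊ partner c a /2⌋ ≟ partner ⌊ c /2⌋ ⌊ a /2⌋) →-dec (a + partner c a + c ≟ 0)) 8) 60)

  -- The hypothesis `b < partner c a` itself bounds `b`, so the check is finite whatever the size of
  -- the second pile.
  small-excluded : ∀ {a} → a < 60 → ∀ {c} → c < 8 → ∀ {b} → b < partner c a → a < partner c b →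
    ⌊ b /2⌋ ≡ partner ⌊ c /2⌋ ⌊ a /2⌋ ⊎ ∃ λ c′ → c′ < c × b ≡ partner c′ a
  small-excluded = from-yes (allUpTo? (λ a → allUpTo? (λ c → allUpTo? (λ b →
    (a <? partner c b) →-dec
    ((⌊ b /2⌋ ≟ partner ⌊ c /2⌋ ⌊ a /2⌋) ⊎-dec anyUpTo? (λ c′ → b ≟ partner c′ a) c))
    (partner c a)) 8) 60)

-- Partners of large piles

toggle-involutive : ∀ i n → toggle i (toggle i n) ≡ n
toggle-involutive true  = flip₁-involutive
toggle-involutive false n = refl

toggle-not≢ : ∀ i n → toggle (not i) n ≢ toggle i n
toggle-not≢ true  n = flip₁≢ n ∘ sym
toggle-not≢ false n = flip₁≢ n

oddLevel-toggle : ∀ i n → oddLevel (toggle i (14 + n)) ≡ oddLevel (14 + n)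
oddLevel-toggle true  n = oddLevel-flip₁ n
oddLevel-toggle false n = refl

-- Toggling raises a number by at most one, so if either side is left untoggled the two inequalities
-- contradict each other. The bits `i` and `j` are independent because they come from the levels of
-- different piles.
toggle-crossing : ∀ i j x y → x < toggle i y → y < toggle j x → x ≡ y × i ≡ true
toggle-crossing true  true  x y p q = flip₁-crossing x y p q , refl
toggle-crossing true  false x y p q =
  contradiction (<-≤-trans q (≤-pred (≤-trans p (flip₁≤ y)))) (<-irrefl refl)
toggle-crossing false true  x y p q =
  contradiction (<-≤-trans p (≤-pred (≤-trans q (flip₁≤ x)))) (<-irrefl refl)
toggle-crossing false false x y p q = contradiction (<-trans p q) (<-irrefl refl)

odd-halfPartner-2 : ∀ n → odd (halfPartner 2 (suc n)) ≡ not (odd (suc n))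
odd-halfPartner-2 n = cong not (odd-flip₁ n)

odd-halfPartner-3 : ∀ n → odd (halfPartner 3 (3 + n)) ≡ odd (3 + n)
odd-halfPartner-3 n = cong (not ∘ not ∘ not) (odd-flip₂ n)

-- In rows 0 and 1 the toggle preserves the level, so the same toggle is applied twice. In the other
-- rows `31 + n` is split as `30 + (1 + n)` or `28 + (3 + n)`, the flip passes the constant by
-- computation, and `pred` leaves 29 or 27.
halfPartner-involutive : ∀ k n → halfPartner k (halfPartner k (30 + n)) ≡ 30 + n
halfPartner-involutive 0 n =
  trans (cong (λ i → toggle i (toggle e (30 + n))) (oddLevel-toggle e (16 + n)))
        (toggle-involutive e (30 + n))
  where e = oddLevel (30 + n)
halfPartner-involutive 1 n =
  trans (cong (λ i → toggle (not i) (toggle e (30 + n))) (oddLevel-toggle e (16 + n)))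
        (toggle-involutive e (30 + n))
  where e = not (oddLevel (30 + n))
halfPartner-involutive 2 n = cong (λ m → 29 + m) (flip₁-involutive (1 + n))
halfPartner-involutive (suc (suc (suc _))) n = cong (λ m → 27 + m) (flip₂-involutive (3 + n))

toggle≥27 : ∀ i n → 27 ≤ toggle i (30 + n)
toggle≥27 true  n = m≤m+n 27 _
toggle≥27 false n = m≤m+n 27 _

halfPartner≥27 : ∀ k n → 27 ≤ halfPartner k (30 + n)
halfPartner≥27 0 n = toggle≥27 (oddLevel (30 + n)) n
halfPartner≥27 1 n = toggle≥27 (not (oddLevel (30 + n))) n
halfPartner≥27 2 n = m≤m+n 27 _
halfPartner≥27 (suc (suc (suc _))) n = m≤m+n 27 _

halfPartner-2≢toggle : ∀ n i → halfPartner 2 (30 + n) ≢ toggle i (30 + n)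
halfPartner-2≢toggle n true  eq = flip₁-suc≢ n (+-cancelˡ-≡ 29 _ _ eq)
halfPartner-2≢toggle n false eq = not-¬ (cong odd eq) (odd-halfPartner-2 (29 + n))

halfPartner-3≢toggle : ∀ n i → halfPartner 3 (30 + n) ≢ toggle i (30 + n)
halfPartner-3≢toggle n true  eq =
  not-¬ (trans (cong odd (sym eq)) (odd-halfPartner-3 (27 + n))) (odd-flip₁ (30 + n))
halfPartner-3≢toggle n false eq = flip₂≢ (3 + n) (+-cancelˡ-≡ 27 _ _ eq)

-- Rows 0 and 1 toggle oppositely. Row 2 changes the parity and row 3 keeps it, which separates
-- these two; each differs from a toggle either in parity or by comparing the flips.
halfPartner-distinct : ∀ k k′ n → k < 4 → k′ < k → halfPartner k (30 + n) ≢ halfPartner k′ (30 + n)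
halfPartner-distinct 1 0 n _ _ = toggle-not≢ (oddLevel (30 + n)) (30 + n)
halfPartner-distinct 2 0 n _ _ = halfPartner-2≢toggle n (oddLevel (30 + n))
halfPartner-distinct 2 1 n _ _ = halfPartner-2≢toggle n (not (oddLevel (30 + n)))
halfPartner-distinct 3 0 n _ _ = halfPartner-3≢toggle n (oddLevel (30 + n))
halfPartner-distinct 3 1 n _ _ = halfPartner-3≢toggle n (not (oddLevel (30 + n)))
halfPartner-distinct 3 2 n _ _ eq =
  not-¬ (trans (cong odd (sym eq)) (odd-halfPartner-3 (27 + n))) (odd-halfPartner-2 (29 + n))
halfPartner-distinct 1 (suc k′) n _ (s≤s ())
halfPartner-distinct 2 (suc (suc k′)) n _ (s≤s (s≤s ()))
halfPartner-distinct 3 (suc (suc (suc k′))) n _ (s≤s (s≤s (s≤s ())))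
halfPartner-distinct (suc (suc (suc (suc k)))) k′ n (s≤s (s≤s (s≤s (s≤s ())))) _

-- Rows 0 and 1 toggle at opposite levels, so one of them is the identity at the given pile. This
-- yields a smaller third pile when the two half-size piles are equal.
halfPartner-fixed : ∀ n → ∃ λ k → k < 2 × 30 + n ≡ halfPartner k (30 + n)
halfPartner-fixed n = choose (oddLevel (30 + n)) refl
  where
  choose : ∀ i → oddLevel (30 + n) ≡ i → ∃ λ k → k < 2 × 30 + n ≡ halfPartner k (30 + n)
  choose true  eq = 1 , s≤s (s≤s z≤n) , cong (λ i → toggle (not i) (30 + n)) (sym eq)
  choose false eq = 0 , s≤s z≤n , cong (λ i → toggle i (30 + n)) (sym eq)

-- With `i` the level parity of the half, exactly one of the pile and its half is toggled, so
-- exactly one side equals `n`.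
toggle-halve₀ : ∀ i n → toggle (not i) n ≢ join (odd n xor false) (toggle i ⌊ n /2⌋)
toggle-halve₀ true  n eq = flip₁≢ ⌊ n /2⌋ (sym (trans (cong ⌊_/2⌋ eq) (half-join _ _)))
toggle-halve₀ false n eq =
  not-¬ (trans (cong odd eq) (trans (odd-join _ ⌊ n /2⌋) (xor-identityʳ (odd n)))) (odd-flip₁ n)

toggle-halve₁ : ∀ i n → toggle i n ≢ join (odd n xor true) (toggle i ⌊ n /2⌋)
toggle-halve₁ true  n eq =
  flip₁≢ ⌊ n /2⌋ (sym (trans (sym (half-flip₁ n)) (trans (cong ⌊_/2⌋ eq) (half-join _ _))))
toggle-halve₁ false n eq =
  not-¬ refl (trans (cong odd eq) (trans (odd-join _ ⌊ n /2⌋) (xor-comm (odd n) true)))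

-- The left side is the half of a large pile's partner, the right side what that half would have to
-- be for the halved position to be paired. Rows 0 and 1 fail because halving flips the level
-- parity, rows 2 and 3 because the parities of the two sides differ.
halfPartner-halve≢ : ∀ k n → k < 4 → halfPartner k (30 + n) ≢ largePartner k (30 + n)
halfPartner-halve≢ 0 n _ eq =
  toggle-halve₀ (oddLevel (15 + ⌊ n /2⌋)) (30 + n)
    (trans (cong (λ i → toggle i (30 + n)) (sym (oddLevel-half (16 + n)))) eq)
halfPartner-halve≢ 1 n _ eq =
  toggle-halve₁ (oddLevel (15 + ⌊ n /2⌋)) (30 + n)
    (trans (cong (λ i → toggle i (30 + n)) (sym level)) eq)
  where
  level : not (oddLevel (30 + n)) ≡ oddLevel (15 + ⌊ n /2⌋)
  level = trans (cong not (oddLevel-half (16 + n))) (not-involutive _)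
halfPartner-halve≢ 2 n _ eq =
  not-¬ (trans (cong odd eq) (trans (odd-largePartner 2 (30 + n)) (xor-identityʳ (odd (30 + n)))))
        (odd-halfPartner-2 (29 + n))
halfPartner-halve≢ 3 n _ eq =
  not-¬ {odd (30 + n)} refl (trans (sym (odd-halfPartner-3 (27 + n)))
                    (trans (cong odd eq)
                    (trans (odd-largePartner 3 (30 + n)) (xor-comm (odd (30 + n)) true))))
halfPartner-halve≢ (suc (suc (suc (suc k)))) n (s≤s (s≤s (s≤s (s≤s ()))))

-- The crossing lemmas force the piles to be equal or, in row 3, possibly neighbours. Equal piles
-- are paired by row 0 or 1. For `k` equal to 0 no smaller row exists, but the pile has odd level,
-- so its half is untoggled and `largePartner 0` fixes the pile.
halfPartner-excluded : ∀ k m n → 30 + n < halfPartner k (30 + m) → 30 + m < halfPartner k (30 + n) →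
  30 + n ≡ largePartner k (30 + m) ⊎ ∃ λ k′ → k′ < k × 30 + n ≡ halfPartner k′ (30 + m)
halfPartner-excluded 0 m n p q with toggle-crossing _ _ _ _ q p
... | refl , lev = inj₁ (sym (trans
  (cong (λ i → join (odd (30 + m) xor false) (toggle i (15 + ⌊ m /2⌋)))
        (not-injective (trans (sym (oddLevel-half (16 + m))) lev)))
  (trans (cong (λ i → join i (15 + ⌊ m /2⌋)) (xor-identityʳ (odd (30 + m))))
         (join-digits (30 + m)))))
halfPartner-excluded 1 m n p q with toggle-crossing _ _ _ _ q p
... | refl , lev = inj₂ (0 , s≤s z≤n ,
  cong (λ i → toggle i (30 + m)) (sym (not-injective lev)))
halfPartner-excluded 2 m n p q
  with refl ← flip₁-crossing (1 + n) (1 + m) (+-cancelˡ-< 29 _ _ p) (+-cancelˡ-< 29 _ _ q)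
  = inj₂ (halfPartner-fixed m)
halfPartner-excluded (suc (suc (suc k))) m n p q
  with flip₂-crossing (3 + n) (3 + m) (+-cancelˡ-< 27 _ _ p) (+-cancelˡ-< 27 _ _ q)
... | inj₂ eq = inj₂ (2 , s≤s (s≤s (s≤s z≤n)) , cong (λ m → 27 + m) eq)
... | inj₁ refl with halfPartner-fixed m
...   | k′ , k′<2 , eq = inj₂ (k′ , ≤-trans k′<2 (s≤s (s≤s z≤n)) , eq)

-- The paired positions form the kernel of the game

30≤largePartner : ∀ c n → 30 ≤ largePartner c (60 + n)
30≤largePartner c n = ≤-trans (m≤m+n 30 24)
  (join-mono (odd (60 + n) xor odd c) (halfPartner≥27 ⌊ c /2⌋ ⌊ n /2⌋))

partner-large : ∀ c {a} → 30 ≤ a → partner c a ≡ largePartner c a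
partner-large c 30≤a =
  subst (λ a → partner c a ≡ largePartner c a) (m+[n∸m]≡n 30≤a) refl

largePartner-involutive : ∀ c n → largePartner c (largePartner c (60 + n)) ≡ 60 + n
largePartner-involutive c n = trans (cong₂ join low high) (join-digits (60 + n))
  where
  low : odd (largePartner c (60 + n)) xor odd c ≡ odd (60 + n)
  low = trans (cong (_xor odd c) (odd-largePartner c (60 + n)))
       (trans (xor-assoc (odd (60 + n)) (odd c) (odd c))
       (trans (cong (odd (60 + n) xor_) (xor-same (odd c))) (xor-identityʳ (odd (60 + n)))))
  high : halfPartner ⌊ c /2⌋ ⌊ largePartner c (60 + n) /2⌋ ≡ 30 + ⌊ n /2⌋
  high = trans (cong (halfPartner ⌊ c /2⌋) (half-largePartner c (60 + n)))
               (halfPartner-involutive ⌊ c /2⌋ ⌊ n /2⌋)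

-- From 60 on, a pile and its half both obey the formula for piles of at least 30. In the form
-- `60 + n` the half computes to `30 + ⌊ n /2⌋`.
data Size : ℕ → Set where
  small : ∀ {a} → a < 60 → Size a
  large : ∀ n → Size (60 + n)

size : ∀ a → Size a
size a with a <? 60
... | yes a<60 = small a<60
... | no  a≮60 = subst Size (m+[n∸m]≡n (≮⇒≥ a≮60)) (large (a ∸ 60))

half<4 : ∀ {c} → c < 8 → ⌊ c /2⌋ < 4
half<4 (s≤s c≤7) = s≤s (⌊n/2⌋-mono c≤7)

partner-involutive : ∀ {c} a → c < 8 → partner c (partner c a) ≡ a
partner-involutive {c} a c<8 with size a
... | small a<60 = small-involutive a<60 c<8
... | large n    = trans (partner-large c (30≤largePartner c n)) (largePartner-involutive c n)

partner-sym : ∀ {a b c} → c < 8 → b ≡ partner c a → a ≡ partner c b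
partner-sym {a} c<8 refl = sym (partner-involutive a c<8)

-- Third piles with different halves use different rows of `halfPartner`; those with equal halves
-- differ in the lowest digit, and so do the partners.
partner-distinct : ∀ {a c c′} → c < 8 → c′ < c → partner c a ≢ partner c′ a
partner-distinct {a} {c} {c′} c<8 c′<c with size a
... | small a<60 = small-distinct a<60 c<8 c′<c
... | large n    = λ eq → apart (join-injective eq)
  where
  apart : ¬ (odd (60 + n) xor odd c ≡ odd (60 + n) xor odd c′ ×
             halfPartner ⌊ c /2⌋ (30 + ⌊ n /2⌋) ≡ halfPartner ⌊ c′ /2⌋ (30 + ⌊ n /2⌋))
  apart (low , high) with m≤n⇒m<n∨m≡n (⌊n/2⌋-mono (<⇒≤ c′<c))
  ... | inj₁ k′<k = halfPartner-distinct _ _ ⌊ n /2⌋ (half<4 c<8) k′<k high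
  ... | inj₂ k′≡k = <-irrefl c′≡c c′<c
    where
    odd≡ : odd c′ ≡ odd c
    odd≡ = trans (xor-solve (odd (60 + n)) (sym low))
                 (sym (xor-solve (odd (60 + n)) refl))
    c′≡c : c′ ≡ c
    c′≡c = trans (digits odd≡ k′≡k) (join-digits c)

partner-halve : ∀ {a c} → c < 8 →
                ⌊ partner c a /2⌋ ≡ partner ⌊ c /2⌋ ⌊ a /2⌋ → a + partner c a + c ≡ 0
partner-halve {a} {c} c<8 eq with size a
... | small a<60 = small-halve a<60 c<8 eq
... | large n    = contradiction (trans (sym (half-largePartner c (60 + n))) eq)
                                 (halfPartner-halve≢ ⌊ c /2⌋ ⌊ n /2⌋ (half<4 c<8))

-- The obstacles to pairing `a` with `b` other than removal from these two piles: halving, or a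
-- smaller third pile, reaches a paired position.
Excluded : ℕ → ℕ → ℕ → Set
Excluded a b c = ⌊ b /2⌋ ≡ partner ⌊ c /2⌋ ⌊ a /2⌋ ⊎ ∃ λ c′ → c′ < c × b ≡ partner c′ a

Excluded-sym : ∀ {a b c} → c < 8 → Excluded a b c → Excluded b a c
Excluded-sym {c = c} c<8 (inj₁ eq) = inj₁ (partner-sym (≤-<-trans (⌊n/2⌋≤n c) c<8) eq)
Excluded-sym c<8 (inj₂ (c′ , c′<c , eq)) =
  inj₂ (c′ , c′<c , partner-sym (<-trans c′<c c<8) eq)

-- Each inequality is read lexicographically: it holds strictly between halves, or the halves agree
-- and the lowest digits decide.
large-excluded : ∀ c m n → 60 + n < partner c (60 + m) → 60 + m < partner c (60 + n) →
                 Excluded (60 + m) (60 + n) c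
large-excluded c m n p q = split (join-<⁻ _ _ _ _ p′) (join-<⁻ _ _ _ _ q′)
  where
  i = odd (60 + m)
  j = odd (60 + n)
  l = odd c
  k = ⌊ c /2⌋
  A = 30 + ⌊ m /2⌋
  B = 30 + ⌊ n /2⌋
  p′ : join j B < join (i xor l) (halfPartner k A)
  p′ = subst (_< partner c (60 + m)) (sym (join-digits (60 + n))) p
  q′ : join i A < join (j xor l) (halfPartner k B)
  q′ = subst (_< partner c (60 + n)) (sym (join-digits (60 + m))) q
  -- The third pile join (i xor j) k′ pairs a and b as soon as k′ pairs their halves.
  b≡ : ∀ k′ → B ≡ halfPartner k′ A → 60 + n ≡ partner (join (i xor j) k′) (60 + m)
  b≡ k′ eq = trans (sym (join-digits (60 + n))) (cong₂ join
    (xor-solve i (sym (odd-join (i xor j) k′)))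
    (trans eq (cong (λ k → halfPartner k A) (sym (half-join (i xor j) k′)))))
  split : B < halfPartner k A ⊎ (B ≡ halfPartner k A × j ≡ false × i xor l ≡ true) →
          A < halfPartner k B ⊎ (A ≡ halfPartner k B × i ≡ false × j xor l ≡ true) →
          Excluded (60 + m) (60 + n) c
  split (inj₁ B<) (inj₁ A<) with halfPartner-excluded k ⌊ m /2⌋ ⌊ n /2⌋ B< A<
  ... | inj₁ eq              = inj₁ eq
  ... | inj₂ (k′ , k′<k , eq) = inj₂ (join (i xor j) k′ , c′<c , b≡ k′ eq)
    where
    c′<c : join (i xor j) k′ < c
    c′<c = subst (join (i xor j) k′ <_) (join-digits c) (join-mono-< (i xor j) l k′<k)
  -- If one half is the partner of the other, the involution makes the relation mutual, so the other
  -- inequality cannot be strict.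
  split (inj₁ B<) (inj₂ (A≡ , _)) = contradiction B< (<-irrefl (sym
    (trans (cong (halfPartner k) A≡) (halfPartner-involutive k ⌊ n /2⌋))))
  split (inj₂ (B≡ , _)) (inj₁ A<) = contradiction A< (<-irrefl (sym
    (trans (cong (halfPartner k) B≡) (halfPartner-involutive k ⌊ m /2⌋))))
  -- Here `a` and `b` are even and `c` is odd, so removing one coin from the third pile pairs them.
  split (inj₂ (B≡ , j≡ , _)) (inj₂ (_ , i≡ , jl≡)) = inj₂ (join (i xor j) k , c′<c , b≡ k B≡)
    where
    l≡true : l ≡ true
    l≡true = trans (xor-solve j jl≡) (cong (_xor true) j≡)
    c′<c : join (i xor j) k < c
    c′<c = subst₂ _<_ (cong (λ e → join e k) (sym (cong₂ _xor_ i≡ j≡)))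
      (trans (cong (λ e → join e k) (sym l≡true)) (join-digits c))
      (join-false<join-true k)

partner-excluded : ∀ {a b c} → c < 8 → b < partner c a → a < partner c b → Excluded a b c
partner-excluded {a} {b} {c} c<8 p q with size a | size b
... | small a<60 | _          = small-excluded a<60 c<8 p q
... | large _    | small b<60 = Excluded-sym c<8 (small-excluded b<60 c<8 q p)
... | large m    | large n    = large-excluded c m n p q

-- Moves between paired and unpaired positions

data Bounded : Position → Set where
  bounded : ∀ {a b c} → c < 8 → Bounded (a ∷ b ∷ c ∷ [])

data Paired : Position → Set where
  paired : ∀ {a b c} → b ≡ partner c a → Paired (a ∷ b ∷ c ∷ [])

unpair : ∀ {a b c} → Paired (a ∷ b ∷ c ∷ []) → b ≡ partner c a
unpair (paired eq) = eq

paired-stable : ∀ {p q} → Bounded p → Paired p → p ⟶ q → ¬ Paired q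
paired-stable (bounded c<8) (paired b≡) (remove (here a′<a)) (paired b≡′) =
  <-irrefl (trans (partner-sym c<8 b≡′) (sym (partner-sym c<8 b≡))) a′<a
paired-stable (bounded c<8) (paired b≡) (remove (there (here b′<b))) (paired b′≡) =
  <-irrefl (trans b′≡ (sym b≡)) b′<b
paired-stable (bounded {a} c<8) (paired b≡) (remove (there (there (here c′<c)))) (paired b≡′) =
  partner-distinct {a} c<8 c′<c (trans (sym b≡) b≡′)
-- By `partner-halve` the total would be 0, whereas a legal halving strictly lowers it.
paired-stable (bounded {a} {b} {c} c<8) (paired refl) (halve 0<) (paired b/2≡) =
  n≮0 (<-≤-trans (sum-halves< 0<) (≤-reflexive sum≡0))
  where
  sum≡0 : a + (b + (c + 0)) ≡ 0
  sum≡0 = trans (cong (λ n → a + (b + n)) (+-identityʳ c))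
          (trans (sym (+-assoc a b c)) (partner-halve {a} c<8 b/2≡))

-- In the empty position `partner 0 0` is 0, which excludes `b < partner c a`.
nonempty : ∀ a b c → b < partner c a → Any (0 <_) (a ∷ b ∷ c ∷ [])
nonempty (suc a) b       c       _ = here z<s
nonempty zero    (suc b) c       _ = there (here z<s)
nonempty zero    zero    (suc c) _ = there (there (here z<s))

paired-absorbing : ∀ {p} → Bounded p → ¬ Paired p → ∃ λ q → (p ⟶ q) × Paired q
paired-absorbing (bounded {a} {b} {c} c<8) unpaired
  with <-cmp b (partner c a) | <-cmp a (partner c b)
... | tri≈ _ b≡ _ | _           = contradiction (paired b≡) unpaired
... | tri> _ _ b> | _           = _ , remove (there (here b>)) , paired refl
... | tri< _ _ _  | tri≈ _ a≡ _ = contradiction (paired (partner-sym c<8 a≡)) unpaired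
... | tri< _ _ _  | tri> _ _ a> = _ , remove (here a>) , paired (partner-sym c<8 refl)
... | tri< b< _ _ | tri< a< _ _ with partner-excluded c<8 b< a<
...   | inj₁ eq              = _ , halve (nonempty a b c b<) , paired eq
...   | inj₂ (_ , c′<c , eq) = _ , remove (there (there (here c′<c))) , paired eq

partnerKernel : Kernel Bounded Paired
partnerKernel = record
  { closed    = closed
  ; decidable = decidable
  ; stable    = paired-stable
  ; absorbing = paired-absorbing
  }
  where
  closed : ∀ {p q} → Bounded p → p ⟶ q → Bounded q
  closed (bounded c<8) (remove (here _))                    = bounded c<8
  closed (bounded c<8) (remove (there (here _)))            = bounded c<8
  closed (bounded c<8) (remove (there (there (here c′<c)))) = bounded (<-trans c′<c c<8)
  closed (bounded {c = c} c<8) (halve _)                    = bounded (≤-<-trans (⌊n/2⌋≤n c) c<8)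
  decidable : ∀ {p} → Bounded p → Dec (Paired p)
  decidable (bounded {a} {b} {c} _) = map′ paired unpair (b ≟ partner c a)

𝒫⇔partner : ∀ a b c → c < 8 → 𝒫 (a ∷ b ∷ c ∷ []) ⇔ (b ≡ partner c a)
𝒫⇔partner a b c c<8 = ⇔.trans (Kernel.𝒫⇔K partnerKernel (bounded c<8)) (mk⇔ unpair paired)

-- The closed formulas

≡join⇔⊕≡join : ∀ m n i {w x} → (⌊ m /2⌋ ⊕ ⌊ n /2⌋ ≡ w) ⇔ (⌊ n /2⌋ ≡ x) →
               (n ≡ join (odd m xor i) x) ⇔ (m ⊕ n ≡ join i w)
≡join⇔⊕≡join m n i {w} {x} halves = mk⇔
  (λ eq → Equivalence.from (⊕≡join m n i w)
    ( trans (cong odd eq) (odd-join _ x)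
    , Equivalence.from halves (trans (cong ⌊_/2⌋ eq) (half-join (odd m xor i) x)) ))
  (λ eq → let low , high = Equivalence.to (⊕≡join m n i w) eq in
          digits low (Equivalence.to halves high))

⊕≡toggle : ∀ i m n → (m ⊕ n ≡ fromBit i) ⇔ (n ≡ toggle i m)
⊕≡toggle true  = ⊕≡1
⊕≡toggle false = ⊕≡0

sign : Bool → ℤ
sign i = if i then -1ℤ else 1ℤ

-1^ : ∀ n → -1ℤ ℤ.^ n ≡ sign (odd n)
-1^ zero    = refl
-1^ (suc n) rewrite -1^ n with odd n
... | true  = refl
... | false = refl

-- The first term is 1 for even `c` and 2 for odd `c`; adding or subtracting 1 gives 0 or 2,
-- respectively 1 or 3. Thus `odd c` is the lower binary digit and the sign is the upper one, set
-- when `L + ⌊ c /2⌋` is even.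
formula-value : ∀ c L → c < 4 →
  half (+ 3 ℤ.+ -1ℤ ℤ.^ (c + 1)) ℤ.+ -1ℤ ℤ.^ (L + ∣ half (1ℤ ℤ.+ -1ℤ ℤ.^ (⌊ c /2⌋ + 1)) ∣)
    ≡ + join (odd c) (fromBit (not (odd L) xor odd ⌊ c /2⌋))
formula-value 0 L _ rewrite +-identityʳ L | -1^ L with odd L
... | true  = refl
... | false = refl
formula-value 1 L _ rewrite +-identityʳ L | -1^ L with odd L
... | true  = refl
... | false = refl
formula-value 2 L _ rewrite +-comm L 1 | -1^ L with odd L
... | true  = refl
... | false = refl
formula-value 3 L _ rewrite +-comm L 1 | -1^ L with odd L
... | true  = refl
... | false = refl
formula-value (suc (suc (suc (suc c)))) L (s≤s (s≤s (s≤s (s≤s ()))))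

oddLevel-⌊/2⌋ : ∀ {a} → 14 ≤ a → oddLevel ⌊ a /2⌋ ≡ not (oddLevel a)
oddLevel-⌊/2⌋ {a} 14≤a = subst (λ a → oddLevel ⌊ a /2⌋ ≡ not (oddLevel a)) (m+[n∸m]≡n 14≤a)
  (sym (trans (cong not (oddLevel-half (a ∸ 14))) (not-involutive _)))

halfPartner⇔⊕ : ∀ k m n → k < 2 → (m ⊕ n ≡ fromBit (oddLevel m xor odd k)) ⇔ (n ≡ halfPartner k m)
halfPartner⇔⊕ 0 m n _ rewrite xor-identityʳ (oddLevel m) = ⊕≡toggle (oddLevel m) m n
halfPartner⇔⊕ 1 m n _ rewrite xor-comm (oddLevel m) true = ⊕≡toggle (not (oddLevel m)) m n
halfPartner⇔⊕ (suc (suc k)) m n (s≤s (s≤s ()))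

c≤3-formula : ∀ {a} → 30 ≤ a → ∀ b c → c ≤ 3 →
  (b ≡ largePartner c a) ⇔ (a ⊕ b ≡ join (odd c) (fromBit (not (oddLevel a) xor odd ⌊ c /2⌋)))
c≤3-formula {a} 30≤a b c c≤3 = subst
  (λ i → (b ≡ largePartner c a) ⇔ (a ⊕ b ≡ join (odd c) (fromBit (i xor odd ⌊ c /2⌋))))
  -- `halfPartner` refers to the level of the half and the formula to that of `a`; this accounts for
  -- the negation.
  (oddLevel-⌊/2⌋ (≤-trans (m≤m+n 14 16) 30≤a))
  (≡join⇔⊕≡join a b (odd c) (halfPartner⇔⊕ ⌊ c /2⌋ ⌊ a /2⌋ ⌊ b /2⌋ (s≤s (⌊n/2⌋-mono c≤3))))

-- The bound on `m` makes the flipped value a visible successor, so the outer `suc` cancels the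
-- `pred` of `halfPartner`.
suc-halfPartner⇔⊕ : ∀ k {m} → 3 ≤ m → ∀ n → k < 2 →
  (suc m ⊕ n ≡ suc k) ⇔ (n ≡ suc (halfPartner (2 + k) m))
suc-halfPartner⇔⊕ 0 (s≤s (s≤s (s≤s {n = m} z≤n))) n _ = ⊕≡1 (4 + m) n
suc-halfPartner⇔⊕ 1 (s≤s (s≤s (s≤s {n = m} z≤n))) n _ = ⊕≡2 (4 + m) n
suc-halfPartner⇔⊕ (suc (suc k)) _ n (s≤s (s≤s ()))

-- Here `c` is the third pile less 4. Adding 2 to a pile keeps its parity and adds 1 to its half,
-- which undoes the shift by one in rows 2 and 3.
2+⊕2+ : ∀ a b c → 30 ≤ a → c ≤ 3 →
  (b ≡ largePartner (4 + c) a) ⇔ ((2 + a) ⊕ (2 + b) ≡ join (odd (2 + c)) (suc ⌊ c /2⌋))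
2+⊕2+ a b c 30≤a c≤3 = ⇔.trans
  (mk⇔ (λ eq → trans (cong (λ m → 2 + m) eq) shift)
       (λ eq → suc-injective (suc-injective (trans eq (sym shift)))))
  (≡join⇔⊕≡join (2 + a) (2 + b) (odd (2 + c))
    (suc-halfPartner⇔⊕ ⌊ c /2⌋ (≤-trans (m≤m+n 3 12) (⌊n/2⌋-mono 30≤a)) (suc ⌊ b /2⌋)
                       (s≤s (⌊n/2⌋-mono c≤3))))
  where
  shift : 2 + largePartner (4 + c) a ≡
          join (odd (2 + a) xor odd (2 + c)) (suc (halfPartner (2 + ⌊ c /2⌋) ⌊ a /2⌋))
  shift = cong (λ i → join i (suc (halfPartner (2 + ⌊ c /2⌋) ⌊ a /2⌋)))
    (cong₂ _xor_ (sym (not-involutive (odd a))) (not-involutive (odd (2 + c))))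

4≤c-formula : ∀ {a} → 30 ≤ a → ∀ b c → 4 ≤ c → c ≤ 7 →
  (b ≡ largePartner c a) ⇔ ((a + 2) ⊕ (b + 2) ≡ c ∸ 2)
4≤c-formula {a} 30≤a b _ (s≤s (s≤s (s≤s (s≤s {n = c} z≤n)))) (s≤s (s≤s (s≤s (s≤s c≤3)))) =
  subst₂ (λ m v → (b ≡ largePartner (4 + c) a) ⇔ (m ≡ v))
    (cong₂ _⊕_ (+-comm 2 a) (+-comm 2 b)) (join-digits (2 + c))
    (2+⊕2+ a b c 30≤a c≤3)

theorem8 : (a b c : ℕ) → 30 ≤ a → 30 ≤ b →
    (c ≤ 3 →
    𝒫 (a ∷ b ∷ c ∷ []) ⇔
    (+ (a ⊕ b) ≡
    half (+ 3 ℤ.+ -1ℤ ℤ.^ (c + 1))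
    ℤ.+ -1ℤ ℤ.^ (⌊log₂[ a / 7 ]⌋ + ∣ half (1ℤ ℤ.+ -1ℤ ℤ.^ (⌊ c /2⌋ + 1)) ∣)))
    × (4 ≤ c → c ≤ 7 →
    𝒫 (a ∷ b ∷ c ∷ []) ⇔ ((a + 2) ⊕ (b + 2) ≡ c ∸ 2))
theorem8 a b c 30≤a _ = part₁ , part₂
  where
  𝒫⇔largePartner : c < 8 → 𝒫 (a ∷ b ∷ c ∷ []) ⇔ (b ≡ largePartner c a)
  𝒫⇔largePartner c<8 =
    subst (λ x → 𝒫 (a ∷ b ∷ c ∷ []) ⇔ (b ≡ x)) (partner-large c 30≤a) (𝒫⇔partner a b c c<8)
  part₁ : c ≤ 3 → _
  part₁ c≤3 = ⇔.trans (𝒫⇔largePartner (s≤s (≤-trans c≤3 (m≤m+n 3 4))))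
    (⇔.trans (c≤3-formula 30≤a b c c≤3)
    (mk⇔ (λ eq → trans (cong +_ eq) value) (λ eq → +-injective (trans eq (sym value)))))
    where
    value : + join (odd c) (fromBit (not (oddLevel a) xor odd ⌊ c /2⌋)) ≡
      half (+ 3 ℤ.+ -1ℤ ℤ.^ (c + 1))
      ℤ.+ -1ℤ ℤ.^ (⌊log₂[ a / 7 ]⌋ + ∣ half (1ℤ ℤ.+ -1ℤ ℤ.^ (⌊ c /2⌋ + 1)) ∣)
    value = trans
      (cong (λ i → + join (odd c) (fromBit (not i xor odd ⌊ c /2⌋))) (oddLevel-def a))
      (sym (formula-value c ⌊log₂[ a / 7 ]⌋ (s≤s c≤3)))
  part₂ : 4 ≤ c → c ≤ 7 → _
  part₂ 4≤c c≤7 = ⇔.trans (𝒫⇔largePartner (s≤s c≤7)) (4≤c-formula 30≤a b c 4≤c c≤7)
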